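{- Let $f(x)\in\mathbf{Z}[x]$ be a nonconstant separable polynomial, and let $R(f)$ be the set of all primes $q$ that are good for $f(x)$ and such that $f(x)$ has a root modulo $q$. For any finite subset $T$ of $R(f)$ there exists $d\in\mathcal{S}(f)$ such that $d$ is divisible by every prime in $T$.
   Context: Squarefree integers may be negative and are nonzero. For a nonzero rational number $r$, its squarefree part $S(r)$ is the unique squarefree integer $d$ such that $r/d$ is a square in $\mathbf{Q}$. For a separable nonconstant $f(x)\in\mathbf{Z}[x]$, $\mathcal{S}(f)=\{S(f(r)) : r\in\mathbf{Q},\ f(r)\neq 0\}$. An odd prime $q$ is good for $f(x)$ if the reduced polynomial $\bar f(x)\in\mathbf{F}_q[x]$ has the same degree as $f(x)$ and has nonzero discriminant. -}

module Defs where

open import Algebra.Bundles.Raw using (RawRing)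
import Algebra.Definitions.RawMonoid as RawMonoidDefs
open import Data.Bool.Base using (if_then_else_)
open import Data.Fin.Base as Fin using (Fin; zero; suc; toℕ; splitAt; opposite; punchIn)
open import Data.Integer.Base as ℤ using (ℤ; +_)
import Data.Integer.Divisibility as ℤ
open import Data.List.Base using (List; []; _∷_; _++_; map; replicate)
open import Data.Nat.Base as ℕ using (ℕ; zero; suc; _≡ᵇ_)
open import Data.Nat.DivMod using (_/_)
open import Data.Nat.Primality using (Prime)
open import Data.Product.Base using (Σ; ∃; ∃₂; _×_)
open import Data.Rational.Base as ℚ using (ℚ; 0ℚ; _÷_)
open import Data.Rational.Literals using (fromℤ)
open import Data.Sum.Base using ([_,_]′)
open import Level using (0ℓ)
open import Relation.Binary.PropositionalEquality using (_≡_; _≢_)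
open import Relation.Nullary.Negation using (¬_)
open import Relation.Unary using (Pred)

-- Coefficient lists, constant term first. Trailing zeros are allowed, so
-- polynomials are compared with _≈ₚ_ and the degree is read off the
-- coefficients up to the equality of the ring.
Poly : Set → Set
Poly = List

module Polynomials (𝑹 : RawRing 0ℓ 0ℓ) where
  open RawRing 𝑹
  open RawMonoidDefs +-rawMonoid using (sum)

  coeff : Poly Carrier → ℕ → Carrier
  coeff []      _       = 0#
  coeff (a ∷ _) zero    = a
  coeff (_ ∷ p) (suc i) = coeff p i

  infix 4 _≈ₚ_
  _≈ₚ_ : Poly Carrier → Poly Carrier → Set
  p ≈ₚ q = ∀ i → coeff p i ≈ coeff q i

  HasDegree : Poly Carrier → ℕ → Set
  HasDegree p n = ¬ (coeff p n ≈ 0#) × (∀ i → n ℕ.< i → coeff p i ≈ 0#)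

  eval : Poly Carrier → Carrier → Carrier
  eval []      x = 0#
  eval (a ∷ p) x = a + x * eval p x

  infixl 6 _+ₚ_
  _+ₚ_ : Poly Carrier → Poly Carrier → Poly Carrier
  []      +ₚ q       = q
  (a ∷ p) +ₚ []      = a ∷ p
  (a ∷ p) +ₚ (b ∷ q) = (a + b) ∷ (p +ₚ q)

  infixl 7 _*ₚ_
  _*ₚ_ : Poly Carrier → Poly Carrier → Poly Carrier
  []      *ₚ q = []
  (a ∷ p) *ₚ q = map (a *_) q +ₚ (0# ∷ p *ₚ q)

  1ₚ : Poly Carrier
  1ₚ = 1# ∷ []

  -- (a + x p)′ = p + x p′
  derivative : Poly Carrier → Poly Carrier
  derivative []      = []
  derivative (a ∷ p) = p +ₚ (0# ∷ derivative p)

  -- x ^ k * p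
  shift : ℕ → Poly Carrier → Poly Carrier
  shift k p = replicate k 0# ++ p

  Matrix : ℕ → Set
  Matrix n = Fin n → Fin n → Carrier

  signed : ℕ → Carrier → Carrier
  signed zero    x = x
  signed (suc k) x = - signed k x

  -- Laplace expansion along the first row.
  det : ∀ {n} → Matrix n → Carrier
  det {zero}  M = 1#
  det {suc n} M = sum λ j →
    signed (toℕ j) (M zero j * det (λ i k → M (suc i) (punchIn j k)))

  -- The Sylvester matrix of p and p′, where p has formal degree n = m + 1 and
  -- p′ formal degree m: the rows are the coefficients of
  -- x ^ (m - 1) p, …, p, x ^ m p′, …, p′, and the columns correspond to
  -- x ^ (2 m), …, x, 1.
  sylvester : ∀ m → Poly Carrier → Matrix (m ℕ.+ suc m)
  sylvester m p i j = coeff (row (splitAt m i)) (toℕ (opposite j))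
    where
    row = [ (λ k → shift (toℕ (opposite k)) p)
          , (λ k → shift (toℕ (opposite k)) (derivative p)) ]′

  -- The discriminant (-1)^(n(n-1)/2) Res(p, p′) / aₙ of a polynomial
  -- p = aₙ xⁿ + … of degree n = m + 1. The division is carried out inside the
  -- Sylvester matrix: its first column has entries aₙ, n aₙ and zeros only, so
  -- dividing that column by aₙ gives the first column for the monic xⁿ.
  discriminant : ∀ m → Poly Carrier → Carrier
  discriminant m p = signed ((suc m ℕ.* m) / 2) (det λ i j →
    sylvester m (if toℕ j ≡ᵇ 0 then shift (suc m) 1ₚ else p) i j)

-- The ring ℤ/qℤ, presented as ℤ with congruence modulo q as its equality.
ℤ/ : ℕ → RawRing 0ℓ 0ℓ
ℤ/ q = record
  { Carrier = ℤ
  ; _≈_     = λ a b → + q ℤ.∣ a ℤ.- b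
  ; _+_     = ℤ._+_
  ; _*_     = ℤ._*_
  ; -_      = ℤ.-_
  ; 0#      = ℤ.0ℤ
  ; 1#      = ℤ.1ℤ
  }

module ℤ[x] = Polynomials ℤ.+-*-rawRing
module ℚ[x] = Polynomials ℚ.+-*-rawRing
-- With this presentation of ℤ/qℤ, the reduction of f modulo q is f itself.
module 𝔽[x] (q : ℕ) = Polynomials (ℤ/ q)

Nonconstant : Poly ℤ → Set
Nonconstant f = ∃ λ m → ℤ[x].HasDegree f (suc m)

toℚ[x] : Poly ℤ → Poly ℚ
toℚ[x] = map fromℤ

-- f and f′ are coprime in ℚ[x].
Separable : Poly ℤ → Set
Separable f = ∃₂ λ u v → (u *ₚ g) +ₚ (v *ₚ derivative g) ≈ₚ 1ₚ
  where
  open ℚ[x]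
  g = toℚ[x] f

-- f is understood to be nonconstant.
Good : Poly ℤ → ℕ → Set
Good f q = Prime q × q ≢ 2 × ∃ λ m →
  ℤ[x].HasDegree f (suc m) ×
  𝔽[x].HasDegree q f (suc m) ×
  ¬ (𝔽[x].discriminant q m f ≈ 0#)
  where open RawRing (ℤ/ q)

HasRootMod : Poly ℤ → ℕ → Set
HasRootMod f q = ∃ λ a → 𝔽[x].eval q f a ≈ 0#
  where open RawRing (ℤ/ q)

R : Poly ℤ → Pred ℕ 0ℓ
R f q = Good f q × HasRootMod f q

Squarefree : ℤ → Set
Squarefree d = ∀ m → m ℤ.* m ℤ.∣ d → ℤ.∣ m ∣ ≡ 1

-- d = S(r), for r ≢ 0.
IsSquarefreePart : ℚ → ℤ → Set
IsSquarefreePart r d = Squarefree d ×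
  Σ (ℤ.NonZero d) λ d≢0 → ∃ λ s → (r ÷ fromℤ d) {{d≢0}} ≡ s ℚ.* s

𝒮 : Poly ℤ → Pred ℤ 0ℓ
𝒮 f d = ∃ λ r → f[ r ] ≢ 0ℚ × IsSquarefreePart f[ r ] d
  where
  f[_] : ℚ → ℚ
  f[_] = ℚ[x].eval (toℚ[x] f)

{-# OPTIONS --safe #-}

-- If f(a) ≡ f′(a) ≡ 0 mod q, then Horner's scheme at a, read as column operations
-- on the Sylvester matrix of f and f′, makes its last column vanish modulo q; so a
-- root modulo a good prime q is simple. Then f takes a value divisible by q and
-- not by q² in a prescribed class modulo any n prime to q: if y ≡ a mod q and q² ∣ f(y),
-- replace y by y + n q. Treating the primes of T one after the other, with n the
-- square of the product of the primes already treated, gives an integer x such that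
-- f(x) ≠ 0 is divisible by each q ∈ T exactly once. Each such q divides the squarefree
-- part of f(x).
module Submission where

open import Defs
open import Algebra.Bundles using (CommutativeRing)
open import Algebra.Bundles.Raw using (RawRing)
open import Data.Bool.Base using (if_then_else_)
open import Data.Fin.Base as Fin using (Fin; zero; suc; toℕ; inject₁; punchIn; punchOut; fromℕ; fromℕ<; opposite; splitAt)
open import Data.Fin.Induction using (<-weakInduction)
import Data.Fin.Properties as Fin
open import Data.Integer.Base as ℤ using (ℤ; +_; 0ℤ; 1ℤ)
open import Data.Integer.Divisibility using (_∣_)
open import Data.Integer.Divisibility.Signed as Signed using (∣ᵤ⇒∣; ∣⇒∣ᵤ)
import Data.Integer.Properties as ℤ
open import Data.Integer.Tactic.RingSolver using (solve-∀)
open import Data.List.Base using (List; []; _∷_; drop)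
import Data.List.Membership.Propositional as List
open import Data.List.Relation.Unary.All as All using (All; []; _∷_)
open import Data.Nat.Base as ℕ using (ℕ; zero; suc; z≤n; s≤s; _≡ᵇ_)
open import Data.Nat.Coprimality using (Coprime; coprime-Bézout)
import Data.Nat.Divisibility as ℕ
open import Data.Nat.DivMod using (_/_)
open import Data.Nat.GCD using (module Bézout)
open import Data.Nat.Induction using (<-rec)
open import Data.Nat.ListAction using (product)
open import Data.Nat.ListAction.Properties using (∈⇒∣product)
open import Data.Nat.Primality using (Prime; euclidsLemma; prime⇒irreducible; prime⇒nonZero)
open import Data.Nat.Primality.Factorisation using (factorisationHasAllPrimeFactors)
import Data.Nat.Properties as ℕ
open import Data.Nat.Tactic.RingSolver using () renaming (solve-∀ to ℕ-solve-∀)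
open import Data.Product.Base using (∃; ∃₂; _×_; _,_; proj₁)
open import Data.Rational.Base as ℚ using (ℚ)
open import Data.Rational.Literals using (fromℤ)
import Data.Rational.Properties as ℚ
open import Data.Rational.Unnormalised.Base using (*≡*)
import Data.Rational.Unnormalised.Properties as ℚᵘ
import Data.Sign.Base as Sign
import Data.Sign.Properties as Sign
open import Data.Sum.Base as Sum using (_⊎_; inj₁; inj₂; [_,_]′)
open import Data.Vec.Functional using (tail)
open import Function.Base using (_∘_; _$_; case_of_)
open import Level using (0ℓ)
open import Relation.Binary.PropositionalEquality as ≡ using (_≡_; _≢_)
open import Relation.Nullary using (¬_; Dec; does; yes; no; contradiction)
open import Relation.Nullary.Decidable using (dec-true; dec-false; _×-dec_)
open import Relation.Unary using (_∈_)

-- Determinants and discriminants over a commutative ring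

punchIn-inject₁ : ∀ {n} (k : Fin n) → punchIn (inject₁ k) k ≡ suc k
punchIn-inject₁ zero    = ≡.refl
punchIn-inject₁ (suc k) = ≡.cong suc (punchIn-inject₁ k)

punchIn-suc : ∀ {n} (k : Fin n) → punchIn (suc k) k ≡ inject₁ k
punchIn-suc zero    = ≡.refl
punchIn-suc (suc k) = ≡.cong suc (punchIn-suc k)

punchIn-inject₁≡punchIn-suc : ∀ {n} (k : Fin n) {l} → l ≢ k →
                              punchIn (inject₁ k) l ≡ punchIn (suc k) l
punchIn-inject₁≡punchIn-suc zero    {zero}  l≢k = contradiction ≡.refl l≢k
punchIn-inject₁≡punchIn-suc zero    {suc l} l≢k = ≡.refl
punchIn-inject₁≡punchIn-suc (suc k) {zero}  l≢k = ≡.refl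
punchIn-inject₁≡punchIn-suc (suc k) {suc l} l≢k =
  ≡.cong suc (punchIn-inject₁≡punchIn-suc k (l≢k ∘ ≡.cong suc))

inject₁≢suc : ∀ {n} (k : Fin n) → inject₁ k ≢ suc k
inject₁≢suc (suc k) eq = inject₁≢suc k (Fin.suc-injective eq)

punchIn-adjacent : ∀ {n} (j : Fin (suc (suc n))) (k : Fin (suc n)) → j ≢ inject₁ k → j ≢ suc k →
  ∃ λ (l : Fin n) → punchIn j (inject₁ l) ≡ inject₁ k × punchIn j (suc l) ≡ suc k
punchIn-adjacent zero zero j≢k _ = contradiction ≡.refl j≢k
punchIn-adjacent zero (suc k) _ _ = k , ≡.refl , ≡.refl
punchIn-adjacent (suc zero) zero _ j≢sk = contradiction ≡.refl j≢sk
punchIn-adjacent {suc n} (suc (suc j)) zero _ _ = zero , ≡.refl , ≡.refl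
punchIn-adjacent {suc n} (suc j) (suc k) j≢k j≢sk
  with l , p , q ← punchIn-adjacent j k (j≢k ∘ ≡.cong suc) (j≢sk ∘ ≡.cong suc)
  = suc l , ≡.cong suc p , ≡.cong suc q

module Discriminant (𝑹 : CommutativeRing 0ℓ 0ℓ) where
  open CommutativeRing 𝑹 hiding (zero)
  open Polynomials rawRing
  open import Algebra.Properties.Ring ring
  open import Algebra.Properties.Semiring.Sum semiring
  open import Algebra.Properties.Semiring.Mult semiring renaming (_×_ to _⋆_)
  open import Algebra.Solver.Ring.NaturalCoefficients.Default commutativeSemiring
    using (solve; _:=_; _:+_; _:*_)
  open import Relation.Binary.Reasoning.Setoid setoid

  signed-cong : ∀ k {x y} → x ≈ y → signed k x ≈ signed k y
  signed-cong zero    x≈y = x≈y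
  signed-cong (suc k) x≈y = -‿cong (signed-cong k x≈y)

  signed-linear : ∀ k b c x y → signed k (b * x + c * y) ≈ b * signed k x + c * signed k y
  signed-linear zero    b c x y = refl
  signed-linear (suc k) b c x y = begin
    - signed k (b * x + c * y)                ≈⟨ -‿cong (signed-linear k b c x y) ⟩
    - (b * signed k x + c * signed k y)       ≈⟨ -‿+-comm _ _ ⟨
    - (b * signed k x) + - (c * signed k y)   ≈⟨ +-cong (-‿distribʳ-* _ _) (-‿distribʳ-* _ _) ⟩
    b * - signed k x + c * - signed k y       ∎

  sum-cong-adjacent : ∀ {n} (k : Fin n) (s t : Fin (suc n) → Carrier) →
    (∀ j → j ≢ inject₁ k → j ≢ suc k → s j ≈ t j) →
    s (inject₁ k) + s (suc k) ≈ t (inject₁ k) + t (suc k) → sum s ≈ sum t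
  sum-cong-adjacent zero s t s≈t pair = begin
    s zero + (s (suc zero) + sum (tail (tail s))) ≈⟨ +-assoc _ _ _ ⟨
    s zero + s (suc zero) + sum (tail (tail s))   ≈⟨ +-cong pair (sum-cong-≋ λ j → s≈t (suc (suc j)) (λ ()) (λ ())) ⟩
    t zero + t (suc zero) + sum (tail (tail t))   ≈⟨ +-assoc _ _ _ ⟩
    t zero + (t (suc zero) + sum (tail (tail t))) ∎
  sum-cong-adjacent (suc k) s t s≈t pair = +-cong (s≈t zero (λ ()) (λ ()))
    (sum-cong-adjacent k (s ∘ suc) (t ∘ suc)
      (λ j j≢k j≢sk → s≈t (suc j) (j≢k ∘ Fin.suc-injective) (j≢sk ∘ Fin.suc-injective)) pair)

  minor : ∀ {n} → Matrix (suc n) → Fin (suc n) → Matrix n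
  minor M j i l = M (suc i) (punchIn j l)

  term : ∀ {n} → Matrix (suc n) → Fin (suc n) → Carrier
  term M j = signed (toℕ j) (M zero j * det (minor M j))

  det-cong : ∀ {n} {M N : Matrix n} → (∀ i j → M i j ≈ N i j) → det M ≈ det N
  det-cong {zero}  M≈N = refl
  det-cong {suc n} M≈N = sum-cong-≋ λ j → signed-cong (toℕ j)
    (*-cong (M≈N zero j) (det-cong λ i l → M≈N (suc i) (punchIn j l)))

  det-linear : ∀ {n} (M L N : Matrix n) (k : Fin n) b c →
    (∀ i j → j ≢ k → N i j ≈ M i j) → (∀ i j → j ≢ k → N i j ≈ L i j) →
    (∀ i → N i k ≈ b * M i k + c * L i k) → det N ≈ b * det M + c * det L
  det-linear {suc n} M L N k b c N≈M N≈L linear = begin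
    sum (term N)
      ≈⟨ sum-cong-≋ step ⟩
    sum (λ j → b * term M j + c * term L j)
      ≈⟨ ∑-distrib-+ (λ j → b * term M j) (λ j → c * term L j) ⟩
    sum (λ j → b * term M j) + sum (λ j → c * term L j)
      ≈⟨ +-cong (*-distribˡ-sum b (term M)) (*-distribˡ-sum c (term L)) ⟨
    b * sum (term M) + c * sum (term L) ∎
    where
    entry : ∀ j → N zero j * det (minor N j) ≈
                  b * (M zero j * det (minor M j)) + c * (L zero j * det (minor L j))
    entry j with j Fin.≟ k
    ... | yes ≡.refl = begin
      N zero k * det (minor N k)
        ≈⟨ *-congʳ (linear zero) ⟩
      (b * M zero k + c * L zero k) * det (minor N k)
        ≈⟨ solve 5 (λ b c x y d → (b :* x :+ c :* y) :* d := b :* (x :* d) :+ c :* (y :* d)) refl b c _ _ _ ⟩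
      b * (M zero k * det (minor N k)) + c * (L zero k * det (minor N k))
        ≈⟨ +-cong (*-congˡ (*-congˡ (det-cong λ i l → N≈M (suc i) _ (Fin.punchInᵢ≢i k l))))
                  (*-congˡ (*-congˡ (det-cong λ i l → N≈L (suc i) _ (Fin.punchInᵢ≢i k l)))) ⟩
      b * (M zero k * det (minor M k)) + c * (L zero k * det (minor L k)) ∎
    ... | no j≢k = begin
      N zero j * det (minor N j)
        ≈⟨ *-congˡ (det-linear (minor M j) (minor L j) (minor N j) k′ b c
             (λ i l l≢k′ → N≈M (suc i) _ (l≢k′ ∘ punchIn-≡k))
             (λ i l l≢k′ → N≈L (suc i) _ (l≢k′ ∘ punchIn-≡k))
             (λ i → ≡.subst (λ l → N (suc i) l ≈ b * M (suc i) l + c * L (suc i) l)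
                      (≡.sym (Fin.punchIn-punchOut j≢k)) (linear (suc i)))) ⟩
      N zero j * (b * det (minor M j) + c * det (minor L j))
        ≈⟨ solve 5 (λ b c x y d → d :* (b :* x :+ c :* y) := b :* (d :* x) :+ c :* (d :* y)) refl b c _ _ _ ⟩
      b * (N zero j * det (minor M j)) + c * (N zero j * det (minor L j))
        ≈⟨ +-cong (*-congˡ (*-congʳ (N≈M zero j j≢k))) (*-congˡ (*-congʳ (N≈L zero j j≢k))) ⟩
      b * (M zero j * det (minor M j)) + c * (L zero j * det (minor L j)) ∎
      where
      k′ = punchOut j≢k
      punchIn-≡k : ∀ {l} → punchIn j l ≡ k → l ≡ k′
      punchIn-≡k eq = Fin.punchIn-injective j _ _ (≡.trans eq (≡.sym (Fin.punchIn-punchOut j≢k)))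
    step : ∀ j → term N j ≈ b * term M j + c * term L j
    step j = trans (signed-cong (toℕ j) (entry j)) (signed-linear (toℕ j) b c _ _)

  det-scaleColumn : ∀ {n} (M N : Matrix n) (k : Fin n) c →
    (∀ i j → j ≢ k → N i j ≈ M i j) → (∀ i → N i k ≈ c * M i k) → det N ≈ c * det M
  det-scaleColumn M N k c N≈M scaled = begin
    det N                   ≈⟨ det-linear M M N k c 0# N≈M N≈M
                                 (λ i → trans (scaled i) (sym (x+0*y≈x _ _))) ⟩
    c * det M + 0# * det M  ≈⟨ x+0*y≈x _ _ ⟩
    c * det M               ∎
    where
    x+0*y≈x : ∀ x y → x + 0# * y ≈ x
    x+0*y≈x x y = trans (+-congˡ (zeroˡ y)) (+-identityʳ x)

  det-zeroColumn : ∀ {n} (M : Matrix n) (k : Fin n) → (∀ i → M i k ≈ 0#) → det M ≈ 0#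
  det-zeroColumn M k M≈0 = trans
    (det-scaleColumn M M k 0# (λ _ _ _ → refl) (λ i → trans (M≈0 i) (sym (zeroˡ _))))
    (zeroˡ _)

  det-addColumn : ∀ {n} (M N : Matrix (suc n)) (k : Fin n) c →
    (∀ i j → j ≢ suc k → N i j ≈ M i j) →
    (∀ i → N i (suc k) ≈ M i (suc k) + c * M i (inject₁ k)) → det N ≈ det M
  det-addColumn {suc n} M N k c N≈M added =
    sum-cong-adjacent k (term N) (term M) (λ j j≢k j≢sk → signed-cong (toℕ j)
      (*-cong (N≈M zero j j≢sk) (other j j≢k j≢sk))) pair
    where
    other : ∀ j → j ≢ inject₁ k → j ≢ suc k → det (minor N j) ≈ det (minor M j)
    other j j≢k j≢sk with l , l↦k , sl↦sk ← punchIn-adjacent j k j≢k j≢sk =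
      det-addColumn (minor M j) (minor N j) l c
        (λ i l′ l′≢sl → N≈M (suc i) _ λ l′↦sk →
          l′≢sl (Fin.punchIn-injective j _ _ (≡.trans l′↦sk (≡.sym sl↦sk))))
        (λ i → ≡.subst₂ (λ u v → N (suc i) v ≈ M (suc i) v + c * M (suc i) u)
                 (≡.sym l↦k) (≡.sym sl↦sk) (added (suc i)))

    M₀ = M zero (inject₁ k)
    M₁ = M zero (suc k)
    d₀ = det (minor M (inject₁ k))
    d₁ = det (minor M (suc k))
    t  = toℕ (inject₁ k)

    minor₀ : det (minor N (inject₁ k)) ≈ 1# * d₀ + c * d₁
    minor₀ = det-linear (minor M (inject₁ k)) (minor M (suc k)) (minor N (inject₁ k)) k 1# c
      N≈M′
      (λ i l l≢k → trans (N≈M′ i l l≢k)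
        (reflexive (≡.cong (M (suc i)) (punchIn-inject₁≡punchIn-suc k l≢k))))
      (λ i → ≡.subst₂ (λ u v → N (suc i) v ≈ 1# * M (suc i) v + c * M (suc i) u)
        (≡.sym (punchIn-suc k)) (≡.sym (punchIn-inject₁ k))
        (trans (added (suc i)) (+-congʳ (sym (*-identityˡ _)))))
      where
      N≈M′ : ∀ i l → l ≢ k → minor N (inject₁ k) i l ≈ minor M (inject₁ k) i l
      N≈M′ i l l≢k = N≈M (suc i) _ λ l↦sk →
        l≢k (Fin.punchIn-injective (inject₁ k) _ _ (≡.trans l↦sk (≡.sym (punchIn-inject₁ k))))

    minor₁ : det (minor N (suc k)) ≈ d₁
    minor₁ = det-cong λ i l → N≈M (suc i) _ (Fin.punchInᵢ≢i (suc k) l)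

    term₀ : term N (inject₁ k) ≈ signed t (M₀ * d₀) + c * signed t (M₀ * d₁)
    term₀ = begin
      signed t (N zero (inject₁ k) * det (minor N (inject₁ k)))
        ≈⟨ signed-cong t (*-cong (N≈M zero _ (inject₁≢suc k)) minor₀) ⟩
      signed t (M₀ * (1# * d₀ + c * d₁))
        ≈⟨ signed-cong t (solve 5 (λ e c x y m → m :* (e :* x :+ c :* y) := e :* (m :* x) :+ c :* (m :* y)) refl 1# c d₀ d₁ M₀) ⟩
      signed t (1# * (M₀ * d₀) + c * (M₀ * d₁))
        ≈⟨ signed-linear t 1# c _ _ ⟩
      1# * signed t (M₀ * d₀) + c * signed t (M₀ * d₁)
        ≈⟨ +-congʳ (*-identityˡ _) ⟩
      signed t (M₀ * d₀) + c * signed t (M₀ * d₁) ∎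

    signed-suc : ∀ x → signed (toℕ (suc k)) x ≈ - signed t x
    signed-suc x = reflexive (≡.cong (λ k → - signed k x) (≡.sym (Fin.toℕ-inject₁ k)))

    term₁ : term N (suc k) ≈ - (c * signed t (M₀ * d₁)) + term M (suc k)
    term₁ = begin
      signed (toℕ (suc k)) (N zero (suc k) * det (minor N (suc k)))
        ≈⟨ signed-cong (toℕ (suc k)) (*-cong (added zero) minor₁) ⟩
      signed (toℕ (suc k)) ((M₁ + c * M₀) * d₁)
        ≈⟨ signed-suc _ ⟩
      - signed t ((M₁ + c * M₀) * d₁)
        ≈⟨ -‿cong (signed-cong t (trans (distribʳ _ _ _) (+-cong (sym (*-identityˡ _)) (*-assoc _ _ _)))) ⟩
      - signed t (1# * (M₁ * d₁) + c * (M₀ * d₁))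
        ≈⟨ -‿cong (signed-linear t 1# c _ _) ⟩
      - (1# * signed t (M₁ * d₁) + c * signed t (M₀ * d₁))
        ≈⟨ -‿cong (trans (+-congʳ (*-identityˡ _)) (+-comm _ _)) ⟩
      - (c * signed t (M₀ * d₁) + signed t (M₁ * d₁))
        ≈⟨ -‿+-comm _ _ ⟨
      - (c * signed t (M₀ * d₁)) + - signed t (M₁ * d₁)
        ≈⟨ +-congˡ (signed-suc _) ⟨
      - (c * signed t (M₀ * d₁)) + term M (suc k) ∎

    pair : term N (inject₁ k) + term N (suc k) ≈ term M (inject₁ k) + term M (suc k)
    pair = begin
      term N (inject₁ k) + term N (suc k)                          ≈⟨ +-cong term₀ term₁ ⟩
      (term M (inject₁ k) + B) + (- B + term M (suc k))            ≈⟨ +-assoc _ _ _ ⟩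
      term M (inject₁ k) + (B + (- B + term M (suc k)))            ≈⟨ +-congˡ (+-assoc _ _ _) ⟨
      term M (inject₁ k) + (B + - B + term M (suc k))              ≈⟨ +-congˡ (+-congʳ (-‿inverseʳ B)) ⟩
      term M (inject₁ k) + (0# + term M (suc k))                   ≈⟨ +-congˡ (+-identityˡ _) ⟩
      term M (inject₁ k) + term M (suc k)                          ∎
      where B = c * signed t (M₀ * d₁)

  -- Column j is turned into H j by adding x times the already treated column j - 1.
  det-horner : ∀ {n} (M H : Matrix n) x →
    (∀ i j → toℕ j ≡ 0 → H i j ≈ M i j) →
    (∀ i j j′ → toℕ j′ ≡ suc (toℕ j) → H i j′ ≈ M i j′ + x * H i j) → det H ≈ det M
  det-horner {zero}  M H x H₀ H₊ = refl
  det-horner {suc n} M H x H₀ H₊ = trans (det-cong λ i j → sym (≤-mix i (Fin.≤fromℕ j)))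
    (<-weakInduction (λ k → det (mix k) ≈ det M) base step (fromℕ n))
    where
    mix : Fin (suc n) → Matrix (suc n)
    mix k i j = if does (j Fin.≤? k) then H i j else M i j

    ≤-mix : ∀ {k} i {j} → j Fin.≤ k → mix k i j ≈ H i j
    ≤-mix {k} i {j} j≤k rewrite dec-true (j Fin.≤? k) j≤k = refl

    >-mix : ∀ {k} i {j} → k Fin.< j → mix k i j ≈ M i j
    >-mix {k} i {j} k<j rewrite dec-false (j Fin.≤? k) (ℕ.<⇒≱ k<j) = refl

    base : det (mix zero) ≈ det M
    base = det-cong entry
      where
      entry : ∀ i j → mix zero i j ≈ M i j
      entry i zero    = H₀ i zero ≡.refl
      entry i (suc j) = >-mix {zero} i (s≤s z≤n)

    step : ∀ k → det (mix (inject₁ k)) ≈ det M → det (mix (suc k)) ≈ det M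
    step k = trans $ det-addColumn (mix (inject₁ k)) (mix (suc k)) k x entry λ i → begin
      mix (suc k) i (suc k)                        ≈⟨ ≤-mix i ℕ.≤-refl ⟩
      H i (suc k)                                  ≈⟨ H₊ i (inject₁ k) (suc k) (≡.cong suc (≡.sym toℕ-k)) ⟩
      M i (suc k) + x * H i (inject₁ k)            ≈⟨ +-cong (>-mix {inject₁ k} i (s≤s (ℕ.≤-reflexive toℕ-k)))
                                                             (*-congˡ (≤-mix {inject₁ k} i {inject₁ k} ℕ.≤-refl)) ⟨
      mix (inject₁ k) i (suc k) + x * mix (inject₁ k) i (inject₁ k) ∎
      where
      toℕ-k = Fin.toℕ-inject₁ k
      entry : ∀ i j → j ≢ suc k → mix (suc k) i j ≈ mix (inject₁ k) i j
      entry i j j≢sk with ℕ.≤-<-connex (toℕ j) (toℕ (inject₁ k))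
      ... | inj₁ j≤k = trans (≤-mix i (ℕ.m≤n⇒m≤1+n (ℕ.≤-trans j≤k (ℕ.≤-reflexive toℕ-k)))) (sym (≤-mix {inject₁ k} i {j} j≤k))
      ... | inj₂ k<j = trans (>-mix {suc k} i (ℕ.≤∧≢⇒< (≡.subst (ℕ._< toℕ j) toℕ-k k<j)
                        (λ eq → j≢sk (Fin.toℕ-injective (≡.sym eq))))) (sym (>-mix {inject₁ k} i {j} k<j))

  coeffs≈0⇒eval≈0 : ∀ p x → (∀ i → coeff p i ≈ 0#) → eval p x ≈ 0#
  coeffs≈0⇒eval≈0 []      x p≈0 = refl
  coeffs≈0⇒eval≈0 (a ∷ p) x p≈0 = begin
    a + x * eval p x  ≈⟨ +-cong (p≈0 0) (*-congˡ (coeffs≈0⇒eval≈0 p x (p≈0 ∘ suc))) ⟩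
    0# + x * 0#       ≈⟨ +-identityˡ _ ⟩
    x * 0#            ≈⟨ zeroʳ x ⟩
    0#                ∎

  coeff-drop : ∀ k p i → coeff (drop k p) i ≡ coeff p (k ℕ.+ i)
  coeff-drop zero    p       i = ≡.refl
  coeff-drop (suc k) []      i = ≡.refl
  coeff-drop (suc k) (a ∷ p) i = coeff-drop k p i

  eval-drop : ∀ k p x → eval (drop k p) x ≈ coeff p k + x * eval (drop (suc k) p) x
  eval-drop zero    []      x = sym (trans (+-identityˡ _) (zeroʳ x))
  eval-drop (suc k) []      x = sym (trans (+-identityˡ _) (zeroʳ x))
  eval-drop zero    (a ∷ p) x = refl
  eval-drop (suc k) (a ∷ p) x = eval-drop k p x

  coeff-shift : ∀ k p i → coeff (shift k p) (k ℕ.+ i) ≡ coeff p i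
  coeff-shift zero    p i = ≡.refl
  coeff-shift (suc k) p i = coeff-shift k p i

  eval-shift : ∀ k p {x} → eval p x ≈ 0# → eval (shift k p) x ≈ 0#
  eval-shift zero    p     p≈0 = p≈0
  eval-shift (suc k) p {x} p≈0 = begin
    0# + x * eval (shift k p) x  ≈⟨ +-identityˡ _ ⟩
    x * eval (shift k p) x       ≈⟨ *-congˡ (eval-shift k p p≈0) ⟩
    x * 0#                       ≈⟨ zeroʳ x ⟩
    0#                           ∎

  coeff-+ₚ : ∀ p q i → coeff (p +ₚ q) i ≈ coeff p i + coeff q i
  coeff-+ₚ []      q       i       = sym (+-identityˡ _)
  coeff-+ₚ (a ∷ p) []      i       = sym (+-identityʳ _)
  coeff-+ₚ (a ∷ p) (b ∷ q) zero    = refl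
  coeff-+ₚ (a ∷ p) (b ∷ q) (suc i) = coeff-+ₚ p q i

  coeff-derivative : ∀ p i → coeff (derivative p) i ≈ suc i ⋆ coeff p (suc i)
  coeff-derivative []      i       = sym (×-zeroʳ (suc i))
    where
    ×-zeroʳ : ∀ n → n ⋆ 0# ≈ 0#
    ×-zeroʳ zero    = refl
    ×-zeroʳ (suc n) = trans (+-identityˡ _) (×-zeroʳ n)
  coeff-derivative (a ∷ p) zero    = coeff-+ₚ p _ 0
  coeff-derivative (a ∷ p) (suc i) = trans (coeff-+ₚ p _ (suc i)) (+-congˡ (coeff-derivative p i))

  eval-+ₚ : ∀ p q x → eval (p +ₚ q) x ≈ eval p x + eval q x
  eval-+ₚ []      q       x = sym (+-identityˡ _)
  eval-+ₚ (a ∷ p) []      x = sym (+-identityʳ _)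
  eval-+ₚ (a ∷ p) (b ∷ q) x = begin
    (a + b) + x * eval (p +ₚ q) x         ≈⟨ +-congˡ (*-congˡ (eval-+ₚ p q x)) ⟩
    (a + b) + x * (eval p x + eval q x)   ≈⟨ solve 5 (λ a b x u v → (a :+ b) :+ x :* (u :+ v) := (a :+ x :* u) :+ (b :+ x :* v)) refl a b x _ _ ⟩
    (a + x * eval p x) + (b + x * eval q x) ∎

  taylor : ∀ p x h → ∃ λ r →
    eval p (x + h) ≈ eval p x + h * eval (derivative p) x + h * h * r
  taylor []      x h = 0# , sym (begin
    0# + h * 0# + h * h * 0#  ≈⟨ +-cong (+-congˡ (zeroʳ h)) (zeroʳ (h * h)) ⟩
    0# + 0# + 0#              ≈⟨ trans (+-identityʳ _) (+-identityʳ _) ⟩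
    0#                        ∎)
  taylor (a ∷ p) x h with r , expansion ← taylor p x h = P′ + x * r + h * r , (begin
    a + (x + h) * eval p (x + h)
      ≈⟨ +-congˡ (*-congˡ expansion) ⟩
    a + (x + h) * (P + h * P′ + h * h * r)
      ≈⟨ solve 6 (λ a x h P P′ r →
           a :+ (x :+ h) :* (P :+ h :* P′ :+ h :* h :* r) :=
           a :+ x :* P :+ h :* (P :+ x :* P′) :+ h :* h :* (P′ :+ x :* r :+ h :* r)) refl a x h P P′ r ⟩
    a + x * P + h * (P + x * P′) + h * h * (P′ + x * r + h * r)
      ≈⟨ +-congʳ (+-congˡ (*-congˡ (trans (eval-+ₚ p _ x) (+-congˡ (+-identityˡ _))))) ⟨
    a + x * P + h * eval (derivative (a ∷ p)) x + h * h * (P′ + x * r + h * r) ∎)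
    where
    P  = eval p x
    P′ = eval (derivative p) x

  _≈_·_From_ : Poly Carrier → Carrier → Poly Carrier → ℕ → Set
  p ≈ c · q From d = ∀ i → d ℕ.≤ i → coeff p i ≈ c * coeff q i

  shift-From : ∀ k {d n c p q} → p ≈ c · q From d → k ℕ.+ d ℕ.≤ n →
               shift k p ≈ c · shift k q From n
  shift-From k {d} {n} {c} {p} {q} p≈cq k+d≤n i n≤i = ≡.subst
    (λ i → coeff (shift k p) i ≈ c * coeff (shift k q) i) (ℕ.m+[n∸m]≡n k≤i) (begin
      coeff (shift k p) (k ℕ.+ (i ℕ.∸ k))      ≡⟨ coeff-shift k p _ ⟩
      coeff p (i ℕ.∸ k)                        ≈⟨ p≈cq (i ℕ.∸ k) (ℕ.m+n≤o⇒m≤o∸n d (≡.subst (ℕ._≤ i) (ℕ.+-comm k d) k+d≤i)) ⟩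
      c * coeff q (i ℕ.∸ k)                    ≡⟨ ≡.cong (c *_) (coeff-shift k q _) ⟨
      c * coeff (shift k q) (k ℕ.+ (i ℕ.∸ k))  ∎)
    where
    k+d≤i = ℕ.≤-trans k+d≤n n≤i
    k≤i   = ℕ.m+n≤o⇒m≤o k k+d≤i

  derivative-From : ∀ {d c p q} → p ≈ c · q From suc d → derivative p ≈ c · derivative q From d
  derivative-From {d} {c} {p} {q} p≈cq i d≤i = begin
    coeff (derivative p) i            ≈⟨ coeff-derivative p i ⟩
    suc i ⋆ coeff p (suc i)           ≈⟨ ×-congʳ (suc i) (p≈cq (suc i) (s≤s d≤i)) ⟩
    suc i ⋆ (c * coeff q (suc i))     ≈⟨ ×-comm-* (suc i) c _ ⟨
    c * (suc i ⋆ coeff q (suc i))     ≈⟨ *-congˡ (coeff-derivative q i) ⟨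
    c * coeff (derivative q) i        ∎

  sylvesterRow : ∀ m → Poly Carrier → Fin (m ℕ.+ suc m) → Poly Carrier
  sylvesterRow m p i =
    [ (λ k → shift (toℕ (opposite k)) p)
    , (λ k → shift (toℕ (opposite k)) (derivative p)) ]′ (splitAt m i)

  sylvesterRow-From : ∀ m {d c} p q → p ≈ c · q From suc d → ∀ i →
                      sylvesterRow m p i ≈ c · sylvesterRow m q i From (m ℕ.+ d)
  sylvesterRow-From m {d} {c} p q p≈cq i with splitAt m i
  ... | inj₁ k = shift-From (toℕ (opposite k)) {p = p} {q} p≈cq
    (≡.subst (ℕ._≤ m ℕ.+ d) (≡.sym (ℕ.+-suc _ d)) (ℕ.+-monoˡ-≤ d (Fin.toℕ<n (opposite k))))
  ... | inj₂ k = shift-From (toℕ (opposite k)) {p = derivative p} {derivative q}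
    (derivative-From {p = p} {q} p≈cq) (ℕ.+-monoˡ-≤ d (ℕ.s≤s⁻¹ (Fin.toℕ<n (opposite k))))

  sylvesterRow-root : ∀ m p {x} → eval p x ≈ 0# → eval (derivative p) x ≈ 0# → ∀ i →
                      eval (sylvesterRow m p i) x ≈ 0#
  sylvesterRow-root m p p≈0 p′≈0 i with splitAt m i
  ... | inj₁ k = eval-shift (toℕ (opposite k)) p p≈0
  ... | inj₂ k = eval-shift (toℕ (opposite k)) (derivative p) p′≈0

  toℕ-opposite : ∀ m (j : Fin (m ℕ.+ suc m)) → toℕ j ℕ.+ toℕ (opposite j) ≡ m ℕ.+ m
  toℕ-opposite m j = ≡.trans (≡.cong (toℕ j ℕ.+_) (Fin.opposite-prop j)) (ℕ.suc-injective
    (≡.trans (ℕ.m+[n∸m]≡n (Fin.toℕ<n j)) (ℕ.+-suc m m)))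

  firstColumn lastColumn : ∀ m → Fin (m ℕ.+ suc m)
  firstColumn m = fromℕ< {0} (ℕ.m≤n⇒m≤o+n m (s≤s z≤n))
  lastColumn  m = opposite (firstColumn m)

  toℕ-firstColumn : ∀ m → toℕ (firstColumn m) ≡ 0
  toℕ-firstColumn m = Fin.toℕ-fromℕ< _

  -- With columns indexed by descending powers of x, Horner's scheme for the row
  -- polynomials at x consists of column operations.
  det-sylvester≈0 : ∀ m p x → (∀ i → suc m ℕ.< i → coeff p i ≈ 0#) →
    eval p x ≈ 0# → eval (derivative p) x ≈ 0# → det (sylvester m p) ≈ 0#
  det-sylvester≈0 m p x deg p≈0 p′≈0 = begin
    det (sylvester m p)  ≈⟨ det-horner (sylvester m p) H x H-first H-next ⟨
    det H                ≈⟨ det-zeroColumn H (lastColumn m) H-last ⟩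
    0#                   ∎
    where
    row = sylvesterRow m p
    H : Matrix (m ℕ.+ suc m)
    H i j = eval (drop (toℕ (opposite j)) (row i)) x

    row-deg : ∀ i n → suc (m ℕ.+ m) ℕ.≤ n → coeff (row i) n ≈ 0#
    row-deg i n 2m<n = trans
      (sylvesterRow-From m {suc m} {0#} p p (λ k sm<k → trans (deg k sm<k) (sym (zeroˡ _))) i n
        (≡.subst (ℕ._≤ n) (≡.sym (ℕ.+-suc m m)) 2m<n))
      (zeroˡ _)

    H-first : ∀ i j → toℕ j ≡ 0 → H i j ≈ sylvester m p i j
    H-first i j j≡0 = begin
      H i j                                             ≈⟨ eval-drop o (row i) x ⟩
      coeff (row i) o + x * eval (drop (suc o) (row i)) x
        ≈⟨ +-congˡ (*-congˡ (coeffs≈0⇒eval≈0 (drop (suc o) (row i)) x λ k →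
             trans (reflexive (coeff-drop (suc o) (row i) k)) (row-deg i _ (s≤s (2m≤o+k k))))) ⟩
      coeff (row i) o + x * 0#                          ≈⟨ trans (+-congˡ (zeroʳ x)) (+-identityʳ _) ⟩
      coeff (row i) o                                   ∎
      where
      o = toℕ (opposite j)
      2m≤o+k : ∀ k → m ℕ.+ m ℕ.≤ o ℕ.+ k
      2m≤o+k k = ℕ.≤-trans (ℕ.≤-reflexive (≡.trans (≡.sym (toℕ-opposite m j)) (≡.cong (ℕ._+ o) j≡0)))
                           (ℕ.m≤m+n o k)

    H-next : ∀ i j j′ → toℕ j′ ≡ suc (toℕ j) → H i j′ ≈ sylvester m p i j′ + x * H i j
    H-next i j j′ j′≡1+j = begin
      H i j′                                                   ≈⟨ eval-drop o′ (row i) x ⟩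
      coeff (row i) o′ + x * eval (drop (suc o′) (row i)) x    ≡⟨ ≡.cong (λ k → coeff (row i) o′ + x * eval (drop k (row i)) x) 1+o′≡o ⟩
      coeff (row i) o′ + x * H i j                             ∎
      where
      o′ = toℕ (opposite j′)
      1+o′≡o : suc o′ ≡ toℕ (opposite j)
      1+o′≡o = ℕ.+-cancelˡ-≡ (toℕ j) _ _ (≡.trans (ℕ.+-suc (toℕ j) o′)
        (≡.trans (≡.cong (ℕ._+ o′) (≡.sym j′≡1+j))
          (≡.trans (toℕ-opposite m j′) (≡.sym (toℕ-opposite m j)))))

    H-last : ∀ i → H i (lastColumn m) ≈ 0#
    H-last i = ≡.subst (λ k → eval (drop k (row i)) x ≈ 0#)
      (≡.sym (≡.trans (≡.cong toℕ (Fin.opposite-involutive (firstColumn m))) (toℕ-firstColumn m)))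
      (sylvesterRow-root m p p≈0 p′≈0 i)

  signed-scale : ∀ n c x → c * signed n x ≈ signed n (c * x)
  signed-scale zero    c x = refl
  signed-scale (suc n) c x = trans (sym (-‿distribʳ-* c _)) (-‿cong (signed-scale n c x))

  signed-0# : ∀ n → signed n 0# ≈ 0#
  signed-0# zero    = refl
  signed-0# (suc n) = trans (-‿cong (signed-0# n)) -0#≈0#

  leading*discriminant≈0 : ∀ m p x → (∀ i → suc m ℕ.< i → coeff p i ≈ 0#) →
    eval p x ≈ 0# → eval (derivative p) x ≈ 0# → coeff p (suc m) * discriminant m p ≈ 0#
  leading*discriminant≈0 m p x deg p≈0 p′≈0 = begin
    c * signed n (det D)        ≈⟨ signed-scale n c (det D) ⟩
    signed n (c * det D)        ≈⟨ signed-cong n (det-scaleColumn D (sylvester m p) (firstColumn m) c other first) ⟨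
    signed n (det (sylvester m p)) ≈⟨ signed-cong n (det-sylvester≈0 m p x deg p≈0 p′≈0) ⟩
    signed n 0#                 ≈⟨ signed-0# n ⟩
    0#                          ∎
    where
    c = coeff p (suc m)
    n = (suc m ℕ.* m) / 2
    xᵐ⁺¹ = shift (suc m) 1ₚ
    D : Matrix (m ℕ.+ suc m)
    D i j = sylvester m (if toℕ j ≡ᵇ 0 then xᵐ⁺¹ else p) i j

    leading : p ≈ c · xᵐ⁺¹ From suc m
    leading i m<i with k , ≡.refl ← ℕ.m≤n⇒∃[o]m+o≡n m<i = begin
      coeff p (suc m ℕ.+ k)           ≈⟨ monomial k ⟩
      c * coeff 1ₚ k                  ≡⟨ ≡.cong (c *_) (coeff-shift (suc m) 1ₚ k) ⟨
      c * coeff xᵐ⁺¹ (suc m ℕ.+ k)    ∎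
      where
      monomial : ∀ k → coeff p (suc m ℕ.+ k) ≈ c * coeff 1ₚ k
      monomial zero    = trans (reflexive (≡.cong (coeff p) (ℕ.+-identityʳ (suc m)))) (sym (*-identityʳ c))
      monomial (suc k) = trans (deg _ (ℕ.m<m+n (suc m) (s≤s z≤n))) (sym (zeroʳ c))

    other : ∀ i j → j ≢ firstColumn m → sylvester m p i j ≈ D i j
    other i j j≢first with toℕ j in j≡
    ... | zero  = contradiction (Fin.toℕ-injective (≡.trans j≡ (≡.sym (toℕ-firstColumn m)))) j≢first
    ... | suc _ = refl

    first : ∀ i → sylvester m p i (firstColumn m) ≈ c * D i (firstColumn m)
    first i rewrite toℕ-firstColumn m = sylvesterRow-From m p xᵐ⁺¹ leading i _
      (ℕ.≤-reflexive (≡.trans (≡.sym (toℕ-opposite m (firstColumn m)))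
        (≡.cong (ℕ._+ toℕ (opposite (firstColumn m))) (toℕ-firstColumn m))))

-- Simple roots modulo good primes

ℤ/-commutativeRing : ℕ → CommutativeRing 0ℓ 0ℓ
ℤ/-commutativeRing q = record
  { RawRing (ℤ/ q)
  ; isCommutativeRing = record
    { isRing = record
      { +-isAbelianGroup = record
        { isGroup = record
          { isMonoid = record
            { isSemigroup = record
              { isMagma = record
                { isEquivalence = record
                  { refl  = λ {a} → ≡⇒≈ {a} ≡.refl
                  ; sym   = λ {a} {b} → ≈-sym a b
                  ; trans = λ {a} {b} {c} → ≈-trans a b c
                  }
                ; ∙-cong = λ {a} {b} {c} {d} → +-cong a b c d
                }
              ; assoc = λ a b c → ≡⇒≈ (ℤ.+-assoc a b c)
              }
            ; identity = ≡⇒≈ ∘ ℤ.+-identityˡ , ≡⇒≈ ∘ ℤ.+-identityʳ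
            }
          ; inverse = ≡⇒≈ ∘ ℤ.+-inverseˡ , ≡⇒≈ ∘ ℤ.+-inverseʳ
          ; ⁻¹-cong = λ {a} {b} → -‿cong a b
          }
        ; comm = λ a b → ≡⇒≈ (ℤ.+-comm a b)
        }
      ; *-cong = λ {a} {b} {c} {d} → *-cong a b c d
      ; *-assoc = λ a b c → ≡⇒≈ (ℤ.*-assoc a b c)
      ; *-identity = ≡⇒≈ ∘ ℤ.*-identityˡ , ≡⇒≈ ∘ ℤ.*-identityʳ
      ; distrib = (λ a b c → ≡⇒≈ (ℤ.*-distribˡ-+ a b c)) , (λ a b c → ≡⇒≈ (ℤ.*-distribʳ-+ a b c))
      }
    ; *-comm = λ a b → ≡⇒≈ (ℤ.*-comm a b)
    }
  }
  where
  _≈_ : ℤ → ℤ → Set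
  _≈_ = RawRing._≈_ (ℤ/ q)

  ≈⇒∣ : ∀ a b → a ≈ b → + q Signed.∣ a ℤ.- b
  ≈⇒∣ a b = ∣ᵤ⇒∣

  ∣⇒≈ : ∀ {c} a b → c ≡ a ℤ.- b → + q Signed.∣ c → a ≈ b
  ∣⇒≈ a b ≡.refl = ∣⇒∣ᵤ

  ≡⇒≈ : ∀ {a b} → a ≡ b → a ≈ b
  ≡⇒≈ {a} ≡.refl = ∣⇒≈ a a (≡.sym (ℤ.+-inverseʳ a)) (Signed.divides 0ℤ ≡.refl)

  ≈-sym : ∀ a b → a ≈ b → b ≈ a
  ≈-sym a b a≈b = ∣⇒≈ b a (identity a b) (Signed.∣m⇒∣-m (≈⇒∣ a b a≈b))
    where
    identity : ∀ a b → ℤ.- (a ℤ.- b) ≡ b ℤ.- a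
    identity = solve-∀

  ≈-trans : ∀ a b c → a ≈ b → b ≈ c → a ≈ c
  ≈-trans a b c a≈b b≈c =
    ∣⇒≈ a c (identity a b c) (Signed.∣m∣n⇒∣m+n (≈⇒∣ a b a≈b) (≈⇒∣ b c b≈c))
    where
    identity : ∀ a b c → a ℤ.- b ℤ.+ (b ℤ.- c) ≡ a ℤ.- c
    identity = solve-∀

  +-cong : ∀ a b c d → a ≈ b → c ≈ d → (a ℤ.+ c) ≈ (b ℤ.+ d)
  +-cong a b c d a≈b c≈d =
    ∣⇒≈ (a ℤ.+ c) (b ℤ.+ d) (identity a b c d) (Signed.∣m∣n⇒∣m+n (≈⇒∣ a b a≈b) (≈⇒∣ c d c≈d))
    where
    identity : ∀ a b c d → a ℤ.- b ℤ.+ (c ℤ.- d) ≡ a ℤ.+ c ℤ.- (b ℤ.+ d)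
    identity = solve-∀

  -‿cong : ∀ a b → a ≈ b → (ℤ.- a) ≈ (ℤ.- b)
  -‿cong a b a≈b = ∣⇒≈ (ℤ.- a) (ℤ.- b) (identity a b) (Signed.∣m⇒∣-m (≈⇒∣ a b a≈b))
    where
    identity : ∀ a b → ℤ.- (a ℤ.- b) ≡ ℤ.- a ℤ.- ℤ.- b
    identity = solve-∀

  *-cong : ∀ a b c d → a ≈ b → c ≈ d → (a ℤ.* c) ≈ (b ℤ.* d)
  *-cong a b c d a≈b c≈d = ∣⇒≈ (a ℤ.* c) (b ℤ.* d) (identity a b c d)
    (Signed.∣m∣n⇒∣m+n (Signed.∣m⇒∣m*n c (≈⇒∣ a b a≈b)) (Signed.∣n⇒∣m*n b (≈⇒∣ c d c≈d)))
    where
    identity : ∀ a b c d → (a ℤ.- b) ℤ.* c ℤ.+ b ℤ.* (c ℤ.- d) ≡ a ℤ.* c ℤ.- b ℤ.* d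
    identity = solve-∀

module _ {q : ℕ} where

  ≈0⇒∣ : ∀ a → RawRing._≈_ (ℤ/ q) a 0ℤ → + q Signed.∣ a
  ≈0⇒∣ a a≈0 = ≡.subst (+ q Signed.∣_) (ℤ.+-identityʳ a) (∣ᵤ⇒∣ a≈0)

  ∣⇒≈0 : ∀ a → + q Signed.∣ a → RawRing._≈_ (ℤ/ q) a 0ℤ
  ∣⇒≈0 a q∣a = ∣⇒∣ᵤ (≡.subst (+ q Signed.∣_) (≡.sym (ℤ.+-identityʳ a)) q∣a)

  eval-mod : ∀ p x → 𝔽[x].eval q p x ≡ ℤ[x].eval p x
  eval-mod []      x = ≡.refl
  eval-mod (a ∷ p) x = ≡.cong (λ e → a ℤ.+ x ℤ.* e) (eval-mod p x)

  +ₚ-mod : ∀ p r → 𝔽[x]._+ₚ_ q p r ≡ ℤ[x]._+ₚ_ p r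
  +ₚ-mod []      r       = ≡.refl
  +ₚ-mod (a ∷ p) []      = ≡.refl
  +ₚ-mod (a ∷ p) (b ∷ r) = ≡.cong (a ℤ.+ b ∷_) (+ₚ-mod p r)

  derivative-mod : ∀ p → 𝔽[x].derivative q p ≡ ℤ[x].derivative p
  derivative-mod []      = ≡.refl
  derivative-mod (a ∷ p) = ≡.trans (+ₚ-mod p _)
    (≡.cong (λ p′ → ℤ[x]._+ₚ_ p (0ℤ ∷ p′)) (derivative-mod p))

prime∣*⇒∣⊎∣ : ∀ {q} → Prime q → ∀ a b → + q Signed.∣ a ℤ.* b → + q Signed.∣ a ⊎ + q Signed.∣ b
prime∣*⇒∣⊎∣ q-prime a b q∣ab = Sum.map ∣ᵤ⇒∣ ∣ᵤ⇒∣
  (euclidsLemma ℤ.∣ a ∣ ℤ.∣ b ∣ q-prime (≡.subst (_ ℕ.∣_) (ℤ.abs-* a b) (∣⇒∣ᵤ q∣ab)))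

good⇒simpleRoot : ∀ {f q} → Good f q → ∀ x → + q Signed.∣ ℤ[x].eval f x →
                  ¬ + q Signed.∣ ℤ[x].eval (ℤ[x].derivative f) x
good⇒simpleRoot {f} {q} (q-prime , _ , m , _ , (lead≉0 , deg) , disc≉0) x q∣f q∣f′ =
  case prime∣*⇒∣⊎∣ q-prime lead disc (≈0⇒∣ (lead ℤ.* disc)
    (leading*discriminant≈0 m f x deg
      (∣⇒≈0 _ (≡.subst (+ q Signed.∣_) (≡.sym (eval-mod f x)) q∣f))
      (∣⇒≈0 _ (≡.subst (+ q Signed.∣_) (≡.sym derivative-eval) q∣f′)))) of λ where
    (inj₁ q∣lead) → lead≉0 (∣⇒≈0 lead q∣lead)
    (inj₂ q∣disc) → disc≉0 (∣⇒≈0 disc q∣disc)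
  where
  open Discriminant (ℤ/-commutativeRing q) using (leading*discriminant≈0)
  lead = 𝔽[x].coeff q f (suc m)
  disc = 𝔽[x].discriminant q m f
  derivative-eval : 𝔽[x].eval q (𝔽[x].derivative q f) x ≡ ℤ[x].eval (ℤ[x].derivative f) x
  derivative-eval = ≡.trans (eval-mod (𝔽[x].derivative q f) x)
    (≡.cong (λ p → ℤ[x].eval p x) (derivative-mod f))

open ℤ[x] using (eval; derivative)
open Discriminant ℤ.+-*-commutativeRing using (taylor)

eval-cong-mod : ∀ f x h {n} → n Signed.∣ h → n Signed.∣ eval f x → n Signed.∣ eval f (x ℤ.+ h)
eval-cong-mod f x h n∣h n∣fx with r , expansion ← taylor f x h = ≡.subst (_ Signed.∣_) (≡.sym expansion)
  (Signed.∣m∣n⇒∣m+n (Signed.∣m∣n⇒∣m+n n∣fx (Signed.∣m⇒∣m*n (eval (derivative f) x) n∣h))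
    (Signed.∣m⇒∣m*n r (Signed.∣m⇒∣m*n h n∣h)))

eval-cong-mod⁻¹ : ∀ f x h {n} → n Signed.∣ h → n Signed.∣ eval f (x ℤ.+ h) → n Signed.∣ eval f x
eval-cong-mod⁻¹ f x h {n} n∣h n∣f = ≡.subst (λ y → n Signed.∣ eval f y) (identity x h)
  (eval-cong-mod f (x ℤ.+ h) (ℤ.- h) (Signed.∣m⇒∣-m n∣h) n∣f)
  where
  identity : ∀ x h → x ℤ.+ h ℤ.+ ℤ.- h ≡ x
  identity = solve-∀

prime∤⇒coprime : ∀ {q n} → Prime q → ¬ q ℕ.∣ n → Coprime n q
prime∤⇒coprime q-prime q∤n (d∣n , d∣q) with prime⇒irreducible q-prime d∣q
... | inj₁ d≡1    = d≡1
... | inj₂ ≡.refl = contradiction d∣n q∤n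

prime∤⇒invertible : ∀ {q n} → Prime q → ¬ q ℕ.∣ n → ∃ λ u → + q Signed.∣ + n ℤ.* u ℤ.- 1ℤ
prime∤⇒invertible {q} {n} q-prime q∤n with coprime-Bézout (prime∤⇒coprime q-prime q∤n)
... | Bézout.+- x y eq = + x , Signed.divides (+ y)
  (≡.trans (≡.cong (ℤ._- 1ℤ) (≡.trans (ℤ.*-comm (+ n) (+ x)) (≡.sym eqℤ))) (identity (+ y ℤ.* + q)))
  where
  eqℤ : 1ℤ ℤ.+ + y ℤ.* + q ≡ + x ℤ.* + n
  eqℤ = ≡.trans (≡.cong (ℤ._+_ 1ℤ) (≡.sym (ℤ.pos-* y q))) (≡.trans (≡.cong +_ eq) (ℤ.pos-* x n))
  identity : ∀ a → 1ℤ ℤ.+ a ℤ.- 1ℤ ≡ a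
  identity = solve-∀
... | Bézout.-+ x y eq = ℤ.- + x , Signed.divides (ℤ.- + y)
  (≡.trans (identity (+ n) (+ x)) (≡.trans (≡.cong ℤ.-_ eqℤ) (ℤ.neg-distribˡ-* (+ y) (+ q))))
  where
  eqℤ : 1ℤ ℤ.+ + x ℤ.* + n ≡ + y ℤ.* + q
  eqℤ = ≡.trans (≡.cong (ℤ._+_ 1ℤ) (≡.sym (ℤ.pos-* x n))) (≡.trans (≡.cong +_ eq) (ℤ.pos-* y q))
  identity : ∀ n x → n ℤ.* (ℤ.- x) ℤ.- 1ℤ ≡ ℤ.- (1ℤ ℤ.+ x ℤ.* n)
  identity = solve-∀

infix 4 _∥_
_∥_ : ℕ → ℤ → Set
q ∥ a = + q Signed.∣ a × ¬ + q ℤ.* + q Signed.∣ a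

∥⇒≢0 : ∀ {q a} → q ∥ a → a ≢ 0ℤ
∥⇒≢0 (_ , q²∤0) ≡.refl = q²∤0 (Signed.divides 0ℤ ≡.refl)

-- Among the lifts y and y + n q of a simple root y modulo q, at most one is a root modulo q².
lift-simpleRoot : ∀ f {q n} → Prime q → ¬ q ℕ.∣ n →
  (∀ x → + q Signed.∣ eval f x → ¬ + q Signed.∣ eval (derivative f) x) →
  ∀ a → + q Signed.∣ eval f a → ∀ x → ∃ λ t → q ∥ eval f (x ℤ.+ + n ℤ.* t)
lift-simpleRoot f {q} {n} q-prime q∤n simple a q∣fa x
  with u , q∣nu-1 ← prime∤⇒invertible q-prime q∤n = lift (_ Signed.∣? _)
  where
  s = u ℤ.* (a ℤ.- x)
  y = x ℤ.+ + n ℤ.* s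
  h = + n ℤ.* + q

  a-to-y : ∀ a x n u → a ℤ.+ (n ℤ.* u ℤ.- 1ℤ) ℤ.* (a ℤ.- x) ≡ x ℤ.+ n ℤ.* (u ℤ.* (a ℤ.- x))
  a-to-y = solve-∀

  y-to-y+h : ∀ x n s q → x ℤ.+ n ℤ.* s ℤ.+ n ℤ.* q ≡ x ℤ.+ n ℤ.* (s ℤ.+ q)
  y-to-y+h = solve-∀

  q∣fy : + q Signed.∣ eval f y
  q∣fy = ≡.subst (λ y → + q Signed.∣ eval f y) (a-to-y a x (+ n) u)
    (eval-cong-mod f a ((+ n ℤ.* u ℤ.- 1ℤ) ℤ.* (a ℤ.- x)) (Signed.∣m⇒∣m*n (a ℤ.- x) q∣nu-1) q∣fa)

  q²∤fy+h : + q ℤ.* + q Signed.∣ eval f y → ¬ + q ℤ.* + q Signed.∣ eval f (y ℤ.+ h)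
  q²∤fy+h q²∣fy q²∣fy+h with r , expansion ← taylor f y h =
    case prime∣*⇒∣⊎∣ q-prime (+ n) (eval (derivative f) y) q∣nf′ of λ where
      (inj₁ q∣n)  → q∤n (∣⇒∣ᵤ q∣n)
      (inj₂ q∣f′) → simple y q∣fy q∣f′
    where
    identity : ∀ n q P P′ r → P ℤ.+ n ℤ.* q ℤ.* P′ ℤ.+ n ℤ.* q ℤ.* (n ℤ.* q) ℤ.* r
                            ≡ P ℤ.+ q ℤ.* q ℤ.* (n ℤ.* n ℤ.* r) ℤ.+ q ℤ.* (n ℤ.* P′)
    identity = solve-∀
    q²∣qnf′ : + q ℤ.* + q Signed.∣ + q ℤ.* (+ n ℤ.* eval (derivative f) y)
    q²∣qnf′ = Signed.∣m+n∣m⇒∣n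
      (≡.subst (_ Signed.∣_) (≡.trans expansion (identity (+ n) (+ q) (eval f y) _ r)) q²∣fy+h)
      (Signed.∣m∣n⇒∣m+n q²∣fy (Signed.∣m⇒∣m*n _ Signed.∣-refl))
    q∣nf′ : + q Signed.∣ + n ℤ.* eval (derivative f) y
    q∣nf′ = Signed.*-cancelˡ-∣ (+ q) {{prime⇒nonZero q-prime}} q²∣qnf′

  lift : Dec (+ q ℤ.* + q Signed.∣ eval f y) → ∃ λ t → q ∥ eval f (x ℤ.+ + n ℤ.* t)
  lift (no  q²∤fy) = s , q∣fy , q²∤fy
  lift (yes q²∣fy) = s ℤ.+ + q , ≡.subst (λ z → q ∥ eval f z) (y-to-y+h x (+ n) s (+ q))
    (eval-cong-mod f y h (Signed.∣n⇒∣m*n (+ n) Signed.∣-refl) q∣fy , q²∤fy+h q²∣fy)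

-- A polynomial with constant term a ≢ 0 does not vanish at ∣ a ∣ + 1, which does not divide a.
nonzero⇒nonroot : ∀ f i → ℤ[x].coeff f i ≢ 0ℤ → ∃ λ x → x ≢ 0ℤ × eval f x ≢ 0ℤ
nonzero⇒nonroot []      i c≢0 = contradiction ≡.refl c≢0
nonzero⇒nonroot (a ∷ p) i c≢0 with a ℤ.≟ 0ℤ
nonzero⇒nonroot (a ∷ p) i c≢0 | no a≢0 = N , (λ ()) , λ fN≡0 →
  ℕ.<⇒≱ ℕ.≤-refl (ℕ.∣⇒≤ {{ℤ.≢-nonZero a≢0}} (∣⇒∣ᵤ (N∣a fN≡0)))
  where
  N = + suc ℤ.∣ a ∣
  N∣a : a ℤ.+ N ℤ.* eval p N ≡ 0ℤ → N Signed.∣ a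
  N∣a fN≡0 = Signed.∣m+n∣n⇒∣m (≡.subst (N Signed.∣_) (≡.sym fN≡0) (Signed.divides 0ℤ ≡.refl))
    (Signed.∣m⇒∣m*n (eval p N) Signed.∣-refl)
nonzero⇒nonroot (a ∷ p) zero    c≢0 | yes a≡0 = contradiction a≡0 c≢0
nonzero⇒nonroot (a ∷ p) (suc i) c≢0 | yes ≡.refl with x , x≢0 , px≢0 ← nonzero⇒nonroot p i c≢0 =
  x , x≢0 , λ fx≡0 → case ℤ.i*j≡0⇒i≡0∨j≡0 x (≡.trans (≡.sym (ℤ.+-identityˡ _)) fx≡0) of λ where
    (inj₁ x≡0)  → x≢0 x≡0
    (inj₂ px≡0) → px≢0 px≡0

exactlyDividedValue : ∀ f → Nonconstant f → ∀ T → All (λ q → q ∈ R f) T →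
                      ∃ λ x → eval f x ≢ 0ℤ × All (λ q → q ∥ eval f x) T
exactlyDividedValue f (m , f≢0 , _) [] [] =
  let x , _ , fx≢0 = nonzero⇒nonroot f (suc m) f≢0 in x , fx≢0 , []
exactlyDividedValue f nonconstant (q ∷ T) ((good , a , fa≈0) ∷ T⊆R) =
  extend (exactlyDividedValue f nonconstant T T⊆R) (q ℕ.∣? P)
  where
  q-prime = proj₁ good
  P = product T
  D = P ℕ.* P

  q∣fa : + q Signed.∣ eval f a
  q∣fa = ≡.subst (+ q Signed.∣_) (eval-mod f a) (≈0⇒∣ (𝔽[x].eval q f a) fa≈0)

  transfer : ∀ x t {r} → r List.∈ T → r ∥ eval f x → r ∥ eval f (x ℤ.+ + D ℤ.* t)
  transfer x t {r} r∈T (r∣fx , r²∤fx) =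
    eval-cong-mod f x h (Signed.∣-trans (Signed.∣m⇒∣m*n (+ r) Signed.∣-refl) r²∣h) r∣fx ,
    r²∤fx ∘ eval-cong-mod⁻¹ f x h r²∣h
    where
    h = + D ℤ.* t
    r∣P = ∈⇒∣product r∈T
    r²∣h : + r ℤ.* + r Signed.∣ h
    r²∣h = Signed.∣m⇒∣m*n t (≡.subst (Signed._∣ + D) (ℤ.pos-* r r) (∣ᵤ⇒∣ (ℕ.*-pres-∣ r∣P r∣P)))

  extend : (∃ λ x → eval f x ≢ 0ℤ × All (λ q → q ∥ eval f x) T) → Dec (q ℕ.∣ P) →
           ∃ λ x → eval f x ≢ 0ℤ × All (λ q → q ∥ eval f x) (q ∷ T)
  extend (x , fx≢0 , T∥fx) (yes q∣P) = x , fx≢0 ,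
    All.lookup T∥fx (factorisationHasAllPrimeFactors q-prime q∣P (All.map (proj₁ ∘ proj₁) T⊆R)) ∷ T∥fx
  extend (x , fx≢0 , T∥fx) (no q∤P) =
    let t , q∥fx′ = lift-simpleRoot f q-prime (q∤P ∘ Sum.reduce ∘ euclidsLemma P P q-prime)
                      (good⇒simpleRoot {f} good) a q∣fa x
    in x ℤ.+ + D ℤ.* t , ∥⇒≢0 q∥fx′ , q∥fx′ ∷ All.tabulate (λ r∈T → transfer x t r∈T (All.lookup T∥fx r∈T))

-- Squarefree parts

squarefreeDecomposition : ∀ n → ℕ.NonZero n →
  ∃₂ λ d s → n ≡ d ℕ.* (s ℕ.* s) × (∀ m → m ℕ.* m ℕ.∣ d → m ≡ 1)
squarefreeDecomposition = <-rec Decomposition decompose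
  where
  Decomposition : ℕ → Set
  Decomposition n = ℕ.NonZero n → ∃₂ λ d s → n ≡ d ℕ.* (s ℕ.* s) × (∀ m → m ℕ.* m ℕ.∣ d → m ≡ 1)

  SquareFactor : ℕ → ℕ → Set
  SquareFactor n m = 2 ℕ.≤ m × m ℕ.* m ℕ.∣ n

  squareFactor? : ∀ n → Dec (∃ λ m → m ℕ.< suc n × SquareFactor n m)
  squareFactor? n = ℕ.anyUpTo? (λ m → 2 ℕ.≤? m ×-dec m ℕ.* m ℕ.∣? n) (suc n)

  noSquareFactor : ∀ n → ℕ.NonZero n → ¬ (∃ λ m → m ℕ.< suc n × SquareFactor n m) →
                   ∀ m → m ℕ.* m ℕ.∣ n → m ≡ 1
  noSquareFactor n n≢0 none 0 0∣n = contradiction (ℕ.0∣⇒≡0 0∣n) (ℕ.≢-nonZero⁻¹ n {{n≢0}})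
  noSquareFactor n n≢0 none 1 _   = ≡.refl
  noSquareFactor n n≢0 none m@(suc (suc _)) m²∣n = contradiction
    (m , s≤s (ℕ.≤-trans (ℕ.m≤m*n m m) (ℕ.∣⇒≤ {{n≢0}} m²∣n)) , s≤s (s≤s z≤n) , m²∣n) none

  identity : ∀ d s m → d ℕ.* (s ℕ.* s) ℕ.* (m ℕ.* m) ≡ d ℕ.* (s ℕ.* m ℕ.* (s ℕ.* m))
  identity = ℕ-solve-∀

  decompose : ∀ n → (∀ {k} → k ℕ.< n → Decomposition k) → Decomposition n
  decompose n rec n≢0 with squareFactor? n
  ... | no  none = n , 1 , ≡.sym (ℕ.*-identityʳ n) , noSquareFactor n n≢0 none
  ... | yes (m , _ , 1<m , ℕ.divides k n≡km²) =
    let d , s , k≡ds² , squarefree = rec k<n k≢0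
    in d , s ℕ.* m , ≡.trans n≡km² (≡.trans (≡.cong (ℕ._* (m ℕ.* m)) k≡ds²) (identity d s m)) , squarefree
    where
    k≢0 : ℕ.NonZero k
    k≢0 = ℕ.m*n≢0⇒m≢0 k {{≡.subst ℕ.NonZero n≡km² n≢0}}
    m≢0 : ℕ.NonZero m
    m≢0 = ℕ.>-nonZero (ℕ.<-trans (s≤s z≤n) 1<m)
    k<n : k ℕ.< n
    k<n = ≡.subst (k ℕ.<_) (≡.sym n≡km²)
      (ℕ.m<m*n k (m ℕ.* m) {{k≢0}} (ℕ.≤-trans 1<m (ℕ.m≤m*n m m {{m≢0}})))

squarefreePart : ∀ n → n ≢ 0ℤ → ∃₂ λ d s → n ≡ d ℤ.* (s ℤ.* s) × Squarefree d × ℤ.NonZero d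
squarefreePart n n≢0
  with d , s , ∣n∣≡ds² , squarefree ← squarefreeDecomposition ℤ.∣ n ∣ (ℤ.≢-nonZero n≢0) =
  ε ℤ.◃ d , + s , n≡ds² ,
  (λ m m²∣d → squarefree ℤ.∣ m ∣ (≡.subst₂ ℕ._∣_ (ℤ.abs-* m m) (ℤ.abs-◃ ε d) m²∣d)) ,
  ℤ.◃-nonZero ε d {{ℕ.m*n≢0⇒m≢0 d {{≡.subst ℕ.NonZero ∣n∣≡ds² (ℤ.≢-nonZero n≢0)}}}}
  where
  ε = ℤ.sign n
  n≡ds² : n ≡ (ε ℤ.◃ d) ℤ.* (+ s ℤ.* + s)
  n≡ds² = begin
    n                                    ≡⟨ ℤ.◃-inverse n ⟨
    ε ℤ.◃ ℤ.∣ n ∣                        ≡⟨ ≡.cong (ε ℤ.◃_) ∣n∣≡ds² ⟩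
    ε ℤ.◃ d ℕ.* (s ℕ.* s)                ≡⟨ ≡.cong (ℤ._◃ d ℕ.* (s ℕ.* s)) (Sign.*-identityʳ ε) ⟨
    ε Sign.* Sign.+ ℤ.◃ d ℕ.* (s ℕ.* s)  ≡⟨ ℤ.◃-distrib-* ε Sign.+ d (s ℕ.* s) ⟩
    (ε ℤ.◃ d) ℤ.* (Sign.+ ℤ.◃ s ℕ.* s)   ≡⟨ ≡.cong ((ε ℤ.◃ d) ℤ.*_) (≡.trans (ℤ.+◃n≡+n (s ℕ.* s)) (ℤ.pos-* s s)) ⟩
    (ε ℤ.◃ d) ℤ.* (+ s ℤ.* + s)          ∎
    where open ≡.≡-Reasoning

∥⇒∣squarefreePart : ∀ {q} → Prime q → ∀ d s → q ∥ (d ℤ.* (s ℤ.* s)) → + q ∣ d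
∥⇒∣squarefreePart {q} q-prime d s (q∣ds² , q²∤ds²) with prime∣*⇒∣⊎∣ q-prime d (s ℤ.* s) q∣ds²
... | inj₁ q∣d  = ∣⇒∣ᵤ q∣d
... | inj₂ q∣s² = contradiction (q²∣ds² (Sum.reduce (prime∣*⇒∣⊎∣ q-prime s s q∣s²))) q²∤ds²
  where
  q²∣ds² : + q Signed.∣ s → + q ℤ.* + q Signed.∣ d ℤ.* (s ℤ.* s)
  q²∣ds² q∣s = Signed.∣n⇒∣m*n d
    (Signed.∣-trans (Signed.*-monoʳ-∣ (+ q) q∣s) (Signed.*-monoˡ-∣ s q∣s))

fromℤ-+ : ∀ a b → fromℤ (a ℤ.+ b) ≡ fromℤ a ℚ.+ fromℤ b
fromℤ-+ a b = ℚ.toℚᵘ-injective (ℚᵘ.≃-trans (*≡* (identity a b))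
  (ℚᵘ.≃-sym (ℚ.toℚᵘ-homo-+ (fromℤ a) (fromℤ b))))
  where
  identity : ∀ a b → (a ℤ.+ b) ℤ.* 1ℤ ≡ (a ℤ.* 1ℤ ℤ.+ b ℤ.* 1ℤ) ℤ.* 1ℤ
  identity = solve-∀

fromℤ-* : ∀ a b → fromℤ (a ℤ.* b) ≡ fromℤ a ℚ.* fromℤ b
fromℤ-* a b = ℚ.toℚᵘ-injective (ℚᵘ.≃-trans (*≡* ≡.refl)
  (ℚᵘ.≃-sym (ℚ.toℚᵘ-homo-* (fromℤ a) (fromℤ b))))

fromℤ-eval : ∀ f x → ℚ[x].eval (toℚ[x] f) (fromℤ x) ≡ fromℤ (eval f x)
fromℤ-eval []      x = ≡.refl
fromℤ-eval (a ∷ f) x = ≡.sym (≡.trans (fromℤ-+ a _) (≡.cong (fromℤ a ℚ.+_)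
  (≡.trans (fromℤ-* x _) (≡.cong (fromℤ x ℚ.*_) (≡.sym (fromℤ-eval f x))))))

fromℤ-injective : ∀ {a b} → fromℤ a ≡ fromℤ b → a ≡ b
fromℤ-injective = ≡.cong ℚ.numerator

isSquarefreePart-fromℤ : ∀ d s → Squarefree d → ℤ.NonZero d →
                         IsSquarefreePart (fromℤ (d ℤ.* (s ℤ.* s))) d
isSquarefreePart-fromℤ d s squarefree d≢0 = squarefree , d≢0 , fromℤ s , (begin
  fromℤ (d ℤ.* (s ℤ.* s)) ℚ.* 1/d                  ≡⟨ ≡.cong (ℚ._* 1/d) (≡.trans (≡.cong fromℤ (ℤ.*-comm d _)) (fromℤ-* (s ℤ.* s) d)) ⟩
  fromℤ (s ℤ.* s) ℚ.* fromℤ d ℚ.* 1/d              ≡⟨ ℚ.*-assoc (fromℤ (s ℤ.* s)) (fromℤ d) 1/d ⟩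
  fromℤ (s ℤ.* s) ℚ.* (fromℤ d ℚ.* 1/d)            ≡⟨ ≡.cong (fromℤ (s ℤ.* s) ℚ.*_) (ℚ.*-inverseʳ (fromℤ d) {{d≢0}}) ⟩
  fromℤ (s ℤ.* s) ℚ.* ℚ.1ℚ                         ≡⟨ ℚ.*-identityʳ _ ⟩
  fromℤ (s ℤ.* s)                                  ≡⟨ fromℤ-* s s ⟩
  fromℤ s ℚ.* fromℤ s                              ∎)
  where
  open ≡.≡-Reasoning
  1/d = (ℚ.1/ fromℤ d) {{d≢0}}

lemma2p2 : (f : Poly ℤ) → Nonconstant f → Separable f →
    (T : List ℕ) → All (λ q → q ∈ R f) T →
    ∃ λ (d : ℤ) → d ∈ 𝒮 f × All (λ q → + q ∣ d) T
lemma2p2 f nonconstant _ T T⊆R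
  with x , fx≢0 , T∥fx ← exactlyDividedValue f nonconstant T T⊆R
  with d , s , fx≡ds² , squarefree , d≢0 ← squarefreePart (eval f x) fx≢0 =
  d , (fromℤ x , (λ f≡0 → fx≢0 (fromℤ-injective (≡.trans (≡.sym (fromℤ-eval f x)) f≡0))) ,
       ≡.subst (λ r → IsSquarefreePart r d) (≡.sym (≡.trans (fromℤ-eval f x) (≡.cong fromℤ fx≡ds²)))
         (isSquarefreePart-fromℤ d s squarefree d≢0)) ,
  All.zipWith (λ ((q-good , _) , q∥fx) →
    ∥⇒∣squarefreePart (proj₁ q-good) d s (≡.subst (_ ∥_) fx≡ds² q∥fx)) (T⊆R , T∥fx)
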